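{- Let $\mathbb{F}_q$ be a finite field with $q$ elements, let $B\in\mathbb{F}_q[x]$ be a polynomial of positive degree, and let $M\in\mathbb{F}_q[x]$ be a polynomial of positive degree. Suppose that $M$ is coprime to $B(B-1)$. Let $T$ be the order of $B$ in the multiplicative group $(\mathbb{F}_q[x]/(M))^*$, and let $$\frac{1}{M} = \sum_{j\ge 1} a_j(x)\,B(x)^{ -j}$$ be the base $B$ expansion of $1/M$, with digits $a_j\in\mathbb{F}_q[x]$, each $a_j$ being zero or of degree less than $\deg B$. Then the sum of the digits over one period vanishes: $$S_B(M)(x) := a_1(x)+a_2(x)+\cdots+a_T(x) = 0 \quad\text{in } \mathbb{F}_q[x].$$
   Context: Base $B$ expansion: for $B\in\mathbb{F}_q[x]$ of positive degree, every rational function $f\in\mathbb{F}_q(x)$ has an expansion $f(x)=\sum_{j=-\infty}^{J} a_{ -j}(x)B(x)^j$ with digits $a_j\in\mathbb{F}_q[x]$ satisfying $\deg a_j<\deg B$ or $a_j=0$. The series converges in the field of formal Laurent series $\mathbb{F}_q((1/x))$, the completion of $\mathbb{F}_q(x)$ with respect to the degree valuation, and the digits are uniquely determined by $f$. When $M$ has positive degree and is coprime to $B$, the expansion of $1/M$ has only the terms $a_jB^{ -j}$ with $j\ge1$ and is purely periodic, $\frac1M=0.\overline{a_1a_2\dots a_T}$ (that is, $a_{j+T}=a_j$ for all $j\ge 1$), with minimal period $T$ equal to the order of $B$ in $(\mathbb{F}_q[x]/(M))^*$. The sum of digits is $S_B(M)=a_1+\cdots+a_T$. -}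

module Defs where

open import Algebra.Bundles using (CommutativeRing; Group; RawRing; Semiring)
open import Algebra.Definitions using (Invertible)
import Algebra.Definitions.RawMagma as Divisibility
import Algebra.Definitions.RawMonoid as Power
import Algebra.Definitions.RawSemiring as RawSemiringDefs
import Algebra.Properties.CommutativeSemigroup as CommutativeSemigroupProperties
import Algebra.Properties.Ring as RingProperties
open import Data.Fin.Base using (Fin; toℕ)
import Data.Fin.Properties as Fin
import Data.Integer.Base as ℤ
open import Data.List.Base using (List; []; _∷_; map)
open import Data.Nat.Base as ℕ using (ℕ; zero; suc)
open import Data.Product.Base using (_×_; _,_; ∃-syntax)
open import Data.Sum.Base using (_⊎_; inj₁; inj₂)
open import Function.Bundles using (Inverse)
open import Function.Base using (_$_)
open import Level using (Level; _⊔_) renaming (suc to lsuc)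
open import Relation.Binary.Bundles using (Setoid)
open import Relation.Binary.Definitions using (Decidable)
import Relation.Binary.PropositionalEquality as ≡
import Relation.Binary.Reasoning.Setoid as SetoidReasoning
open import Relation.Nullary.Decidable using (Dec; yes; no; map′)
open import Relation.Nullary.Negation using (¬_)

private
  variable
    c ℓ : Level

record FiniteField (q : ℕ) c ℓ : Set (lsuc (c ⊔ ℓ)) where
  field
    commutativeRing : CommutativeRing c ℓ

  open CommutativeRing commutativeRing public

  field
    1≉0         : ¬ 1# ≈ 0#
    invertible  : ∀ x → ¬ x ≈ 0# → Invertible _≈_ 1# _*_ x
    enumeration : Inverse setoid (≡.setoid (Fin q))

  private module E = Inverse enumeration

  _≟_ : Decidable _≈_
  x ≟ y = map′
    (λ e → trans (sym (E.inverseʳ ≡.refl)) (trans (E.from-cong e) (E.inverseʳ ≡.refl)))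
    E.to-cong
    (E.to x Fin.≟ E.to y)

  noZeroDivisors : ∀ x y → ¬ x ≈ 0# → x * y ≈ 0# → y ≈ 0#
  noZeroDivisors x y x≉0 xy≈0 with invertible x x≉0
  ... | x⁻¹ , x⁻¹x≈1 , _ = begin
    y                ≈⟨ *-identityˡ y ⟨
    1# * y           ≈⟨ *-congʳ x⁻¹x≈1 ⟨
    (x⁻¹ * x) * y    ≈⟨ *-assoc x⁻¹ x y ⟩
    x⁻¹ * (x * y)    ≈⟨ *-congˡ xy≈0 ⟩
    x⁻¹ * 0#         ≈⟨ zeroʳ x⁻¹ ⟩
    0#               ∎
    where open SetoidReasoning setoid

record IsOrder (G : Group c ℓ) (g : Group.Carrier G) (n : ℕ) : Set ℓ where
  open Group G
  open Power rawMonoid using () renaming (_×_ to power)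
  field
    positive : 0 ℕ.< n
    power≈ε  : power n g ≈ ε
    minimal  : ∀ k → 0 ℕ.< k → power k g ≈ ε → n ℕ.≤ k

module _ (R : CommutativeRing c ℓ) where
  open CommutativeRing R
  open CommutativeSemigroupProperties *-commutativeSemigroup using (interchange)

  record Unit : Set (c ⊔ ℓ) where
    field
      value     : Carrier
      inverse   : Carrier
      value*inv : value * inverse ≈ 1#

  open Unit

  unitGroup : Group (c ⊔ ℓ) ℓ
  unitGroup = record
    { Carrier = Unit
    ; _≈_     = λ u v → value u ≈ value v
    ; _∙_     = _·_
    ; ε       = one
    ; _⁻¹     = λ u → record
      { value = inverse u ; inverse = value u ; value*inv = inv*value u }
    ; isGroup = record
      { isMonoid = record
        { isSemigroup = record
          { isMagma = record
            { isEquivalence = record { refl = refl ; sym = sym ; trans = trans }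
            ; ∙-cong        = *-cong
            }
          ; assoc = λ u v w → *-assoc (value u) (value v) (value w)
          }
        ; identity = (λ u → *-identityˡ (value u)) , (λ u → *-identityʳ (value u))
        }
      ; inverse = inv*value , value*inv
      ; ⁻¹-cong = λ {u} {v} → inv-cong u v
      }
    }
    where
    open SetoidReasoning setoid

    inv*value : ∀ u → inverse u * value u ≈ 1#
    inv*value u = trans (*-comm (inverse u) (value u)) (value*inv u)

    one : Unit
    one = record { value = 1# ; inverse = 1# ; value*inv = *-identityˡ 1# }

    _·_ : Unit → Unit → Unit
    u · v = record
      { value     = value u * value v
      ; inverse   = inverse u * inverse v
      ; value*inv = begin
          (value u * value v) * (inverse u * inverse v)
            ≈⟨ interchange (value u) (value v) (inverse u) (inverse v) ⟩
          (value u * inverse u) * (value v * inverse v)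
            ≈⟨ *-cong (value*inv u) (value*inv v) ⟩
          1# * 1#
            ≈⟨ *-identityˡ 1# ⟩
          1# ∎
      }

    inv-cong : ∀ u v → value u ≈ value v → inverse u ≈ inverse v
    inv-cong u v u≈v = begin
      inverse u                           ≈⟨ *-identityʳ (inverse u) ⟨
      inverse u * 1#                      ≈⟨ *-congˡ (value*inv v) ⟨
      inverse u * (value v * inverse v)   ≈⟨ *-assoc (inverse u) (value v) (inverse v) ⟨
      (inverse u * value v) * inverse v   ≈⟨ *-congʳ (*-congˡ u≈v) ⟨
      (inverse u * value u) * inverse v   ≈⟨ *-congʳ (inv*value u) ⟩
      1# * inverse v                      ≈⟨ *-identityˡ (inverse v) ⟩
      inverse v                           ∎

  -- The class b is a unit, and its order in the unit group is n.
  HasUnitOrder : Carrier → ℕ → Set (c ⊔ ℓ)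
  HasUnitOrder b n = ∃[ u ] value u ≈ b × IsOrder unitGroup u n

module _ (R : CommutativeRing c ℓ) (m : CommutativeRing.Carrier R) where
  open CommutativeRing R
  open RingProperties ring using (-‿distribˡ-*; -‿distribʳ-*; -‿+-comm; -‿involutive)
  open CommutativeSemigroupProperties +-commutativeSemigroup using (interchange)
  open Divisibility *-rawMagma using (_∣_; _,_)
  open SetoidReasoning setoid

  record _≡ᵐ_ (x y : Carrier) : Set (c ⊔ ℓ) where
    constructor mod
    field
      m∣x-y : m ∣ (x - y)

  private
    resp : ∀ {x y} → x ≈ y → m ∣ x → m ∣ y
    resp x≈y (k , km≈x) = k , trans km≈x x≈y

    ∣-+ : ∀ {x y} → m ∣ x → m ∣ y → m ∣ (x + y)
    ∣-+ (j , p) (k , q) = j + k , trans (distribʳ m j k) (+-cong p q)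

    ∣-neg : ∀ {x} → m ∣ x → m ∣ (- x)
    ∣-neg (k , p) = - k , trans (sym (-‿distribˡ-* k m)) (-‿cong p)

    ∣-*ˡ : ∀ {x} z → m ∣ x → m ∣ (z * x)
    ∣-*ˡ z (k , p) = z * k , trans (*-assoc z k m) (*-congˡ p)

    ≈⇒≡ᵐ : ∀ {x y} → x ≈ y → x ≡ᵐ y
    ≈⇒≡ᵐ {x} {y} x≈y = mod $ 0# , trans (zeroˡ m)
      (sym (trans (+-congʳ x≈y) (-‿inverseʳ y)))

    telescope : ∀ x y z → (x - y) + (y - z) ≈ x - z
    telescope x y z = begin
      (x - y) + (y - z)     ≈⟨ +-assoc x (- y) (y - z) ⟩
      x + (- y + (y - z))   ≈⟨ +-congˡ (+-assoc (- y) y (- z)) ⟨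
      x + ((- y + y) - z)   ≈⟨ +-congˡ (+-congʳ (-‿inverseˡ y)) ⟩
      x + (0# - z)          ≈⟨ +-congˡ (+-identityˡ (- z)) ⟩
      x - z                 ∎

    neg-diff : ∀ x y → - (x - y) ≈ y - x
    neg-diff x y = begin
      - (x - y)        ≈⟨ -‿+-comm x (- y) ⟨
      - x + - (- y)    ≈⟨ +-congˡ (-‿involutive y) ⟩
      - x + y          ≈⟨ +-comm (- x) y ⟩
      y - x            ∎

    ≡ᵐ-sym : ∀ {x y} → x ≡ᵐ y → y ≡ᵐ x
    ≡ᵐ-sym (mod p) = mod (resp (neg-diff _ _) (∣-neg p))

    ≡ᵐ-trans : ∀ {x y z} → x ≡ᵐ y → y ≡ᵐ z → x ≡ᵐ z
    ≡ᵐ-trans (mod p) (mod q) = mod (resp (telescope _ _ _) (∣-+ p q))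

    ≡ᵐ-+-cong : ∀ {x y u v} → x ≡ᵐ y → u ≡ᵐ v → (x + u) ≡ᵐ (y + v)
    ≡ᵐ-+-cong {x} {y} {u} {v} (mod p) (mod q) = mod $ resp
      (trans (interchange x (- y) u (- v)) (+-congˡ (-‿+-comm y v))) (∣-+ p q)

    ≡ᵐ-neg-cong : ∀ {x y} → x ≡ᵐ y → (- x) ≡ᵐ (- y)
    ≡ᵐ-neg-cong {x} {y} (mod p) = mod (resp (sym (-‿+-comm x (- y))) (∣-neg p))

    ≡ᵐ-*-congˡ : ∀ z {x y} → x ≡ᵐ y → (z * x) ≡ᵐ (z * y)
    ≡ᵐ-*-congˡ z {x} {y} (mod p) = mod $ resp
      (trans (distribˡ z x (- y)) (+-congˡ (sym (-‿distribʳ-* z y)))) (∣-*ˡ z p)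

    ≡ᵐ-*-cong : ∀ {x y u v} → x ≡ᵐ y → u ≡ᵐ v → (x * u) ≡ᵐ (y * v)
    ≡ᵐ-*-cong {x} {y} {u} {v} p q =
      ≡ᵐ-trans (≡ᵐ-*-congˡ x q)
        (≡ᵐ-trans (≈⇒≡ᵐ (*-comm x v))
          (≡ᵐ-trans (≡ᵐ-*-congˡ v p) (≈⇒≡ᵐ (*-comm v y))))

  residueRing : CommutativeRing c (c ⊔ ℓ)
  residueRing = record
    { Carrier = Carrier
    ; _≈_ = _≡ᵐ_
    ; _+_ = _+_
    ; _*_ = _*_
    ; -_  = -_
    ; 0#  = 0#
    ; 1#  = 1#
    ; isCommutativeRing = record
      { isRing = record
        { +-isAbelianGroup = record
          { isGroup = record
            { isMonoid = record
              { isSemigroup = record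
                { isMagma = record
                  { isEquivalence = record
                    { refl = ≈⇒≡ᵐ refl ; sym = ≡ᵐ-sym ; trans = ≡ᵐ-trans }
                  ; ∙-cong = ≡ᵐ-+-cong
                  }
                ; assoc = λ x y z → ≈⇒≡ᵐ (+-assoc x y z)
                }
              ; identity = (λ x → ≈⇒≡ᵐ (+-identityˡ x)) , (λ x → ≈⇒≡ᵐ (+-identityʳ x))
              }
            ; inverse = (λ x → ≈⇒≡ᵐ (-‿inverseˡ x)) , (λ x → ≈⇒≡ᵐ (-‿inverseʳ x))
            ; ⁻¹-cong = ≡ᵐ-neg-cong
            }
          ; comm = λ x y → ≈⇒≡ᵐ (+-comm x y)
          }
        ; *-cong = ≡ᵐ-*-cong
        ; *-assoc = λ x y z → ≈⇒≡ᵐ (*-assoc x y z)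
        ; *-identity = (λ x → ≈⇒≡ᵐ (*-identityˡ x)) , (λ x → ≈⇒≡ᵐ (*-identityʳ x))
        ; distrib = (λ x y z → ≈⇒≡ᵐ (distribˡ x y z)) , (λ x y z → ≈⇒≡ᵐ (distribʳ x y z))
        }
      ; *-comm = λ x y → ≈⇒≡ᵐ (*-comm x y)
      }
    }

-- Polynomials are coefficient lists, constant term first.  Trailing zeros are
-- allowed; equality compares coefficients.
module Polynomials (R : CommutativeRing c ℓ) where
  private module R = CommutativeRing R
  open R using (0#; 1#) renaming (Carrier to A; _≈_ to _≈ᴿ_)

  Poly : Set c
  Poly = List A

  coeff : Poly → ℕ → A
  coeff []      _       = 0#
  coeff (a ∷ f) zero    = a
  coeff (a ∷ f) (suc i) = coeff f i

  infix 4 _≈_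
  record _≈_ (f g : Poly) : Set ℓ where
    constructor coeffwise
    field
      at : ∀ i → coeff f i ≈ᴿ coeff g i
  open _≈_ public

  infixl 6 _+_
  infixl 7 _*_ _·_
  infix  8 -_

  _+_ : Poly → Poly → Poly
  []      + g       = g
  (a ∷ f) + []      = a ∷ f
  (a ∷ f) + (b ∷ g) = (a R.+ b) ∷ (f + g)

  -_ : Poly → Poly
  - f = map (λ a → R.- a) f

  _·_ : A → Poly → Poly
  a · f = map (a R.*_) f

  _*_ : Poly → Poly → Poly
  []      * g = []
  (a ∷ f) * g = a · g + (0# ∷ f * g)

  0ₚ 1ₚ : Poly
  0ₚ = []
  1ₚ = 1# ∷ []

  private
    coeff-+ : ∀ f g i → coeff (f + g) i ≈ᴿ coeff f i R.+ coeff g i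
    coeff-+ []      g       i       = R.sym (R.+-identityˡ (coeff g i))
    coeff-+ (a ∷ f) []      i       = R.sym (R.+-identityʳ (coeff (a ∷ f) i))
    coeff-+ (a ∷ f) (b ∷ g) zero    = R.refl
    coeff-+ (a ∷ f) (b ∷ g) (suc i) = coeff-+ f g i

    coeff-· : ∀ a f i → coeff (a · f) i ≈ᴿ a R.* coeff f i
    coeff-· a []      i       = R.sym (R.zeroʳ a)
    coeff-· a (b ∷ f) zero    = R.refl
    coeff-· a (b ∷ f) (suc i) = coeff-· a f i

    coeff-neg : ∀ f i → coeff (- f) i ≈ᴿ R.- coeff f i
    coeff-neg []      i       = R.sym (RingProperties.-0#≈0# R.ring)
    coeff-neg (a ∷ f) zero    = R.refl
    coeff-neg (a ∷ f) (suc i) = coeff-neg f i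

    ≈-refl : ∀ {f} → f ≈ f
    ≈-refl .at i = R.refl

    ≈-sym : ∀ {f g} → f ≈ g → g ≈ f
    ≈-sym p .at i = R.sym (p .at i)

    ≈-trans : ∀ {f g h} → f ≈ g → g ≈ h → f ≈ h
    ≈-trans p q .at i = R.trans (p .at i) (q .at i)

    +-cong : ∀ {f f′ g g′} → f ≈ f′ → g ≈ g′ → f + g ≈ f′ + g′
    +-cong {f} {f′} {g} {g′} p q .at i = R.trans (coeff-+ f g i)
      (R.trans (R.+-cong (p .at i) (q .at i)) (R.sym (coeff-+ f′ g′ i)))

    neg-cong : ∀ {f g} → f ≈ g → - f ≈ - g
    neg-cong {f} {g} p .at i = R.trans (coeff-neg f i)
      (R.trans (R.-‿cong (p .at i)) (R.sym (coeff-neg g i)))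

    +-assoc : ∀ f g h → (f + g) + h ≈ f + (g + h)
    +-assoc f g h .at i = begin
      coeff ((f + g) + h) i                   ≈⟨ coeff-+ (f + g) h i ⟩
      coeff (f + g) i R.+ coeff h i           ≈⟨ R.+-congʳ (coeff-+ f g i) ⟩
      coeff f i R.+ coeff g i R.+ coeff h i   ≈⟨ R.+-assoc _ _ _ ⟩
      coeff f i R.+ (coeff g i R.+ coeff h i) ≈⟨ R.+-congˡ (coeff-+ g h i) ⟨
      coeff f i R.+ coeff (g + h) i           ≈⟨ coeff-+ f (g + h) i ⟨
      coeff (f + (g + h)) i                   ∎
      where open SetoidReasoning R.setoid

    +-comm : ∀ f g → f + g ≈ g + f
    +-comm f g .at i = R.trans (coeff-+ f g i)
      (R.trans (R.+-comm _ _) (R.sym (coeff-+ g f i)))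

    +-identityˡ : ∀ f → [] + f ≈ f
    +-identityˡ f = ≈-refl

    +-identityʳ : ∀ f → f + [] ≈ f
    +-identityʳ f = ≈-trans (+-comm f []) ≈-refl

    neg-inverseʳ : ∀ f → f + (- f) ≈ []
    neg-inverseʳ f .at i = R.trans (coeff-+ f (- f) i)
      (R.trans (R.+-congˡ (coeff-neg f i)) (R.-‿inverseʳ _))

    neg-inverseˡ : ∀ f → (- f) + f ≈ []
    neg-inverseˡ f = ≈-trans (+-comm (- f) f) (neg-inverseʳ f)

    +-interchange : ∀ f g h k → (f + g) + (h + k) ≈ (f + h) + (g + k)
    +-interchange = CommutativeSemigroupProperties.interchange record
      { Carrier = Poly ; _≈_ = _≈_ ; _∙_ = _+_
      ; isCommutativeSemigroup = record
        { isSemigroup = record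
          { isMagma = record
            { isEquivalence = record { refl = ≈-refl ; sym = ≈-sym ; trans = ≈-trans }
            ; ∙-cong = +-cong }
          ; assoc = +-assoc }
        ; comm = +-comm } }

    ∷-cong : ∀ {a b f g} → a ≈ᴿ b → f ≈ g → a ∷ f ≈ b ∷ g
    ∷-cong p q .at zero    = p
    ∷-cong p q .at (suc i) = q .at i

    ∷-zero : ∀ {a f} → a ≈ᴿ 0# → f ≈ [] → a ∷ f ≈ []
    ∷-zero p q .at zero    = p
    ∷-zero p q .at (suc i) = q .at i

    tail-zero : ∀ {a f} → a ∷ f ≈ [] → f ≈ []
    tail-zero p .at i = p .at (suc i)

    ·-cong : ∀ {a b f g} → a ≈ᴿ b → f ≈ g → a · f ≈ b · g
    ·-cong {a} {b} {f} {g} p q .at i = R.trans (coeff-· a f i)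
      (R.trans (R.*-cong p (q .at i)) (R.sym (coeff-· b g i)))

    ·-distrib : ∀ a f g → a · (f + g) ≈ a · f + a · g
    ·-distrib a f g .at i = begin
      coeff (a · (f + g)) i                       ≈⟨ coeff-· a (f + g) i ⟩
      a R.* coeff (f + g) i                       ≈⟨ R.*-congˡ (coeff-+ f g i) ⟩
      a R.* (coeff f i R.+ coeff g i)             ≈⟨ R.distribˡ a _ _ ⟩
      a R.* coeff f i R.+ a R.* coeff g i         ≈⟨ R.+-cong (coeff-· a f i) (coeff-· a g i) ⟨
      coeff (a · f) i R.+ coeff (a · g) i         ≈⟨ coeff-+ (a · f) (a · g) i ⟨
      coeff (a · f + a · g) i                     ∎
      where open SetoidReasoning R.setoid

    ·-assoc : ∀ a b f → (a R.* b) · f ≈ a · (b · f)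
    ·-assoc a b f .at i = R.trans (coeff-· (a R.* b) f i)
      (R.trans (R.*-assoc a b _)
        (R.sym (R.trans (coeff-· a (b · f) i) (R.*-congˡ (coeff-· b f i)))))

    0·-zero : ∀ f → 0# · f ≈ []
    0·-zero f .at i = R.trans (coeff-· 0# f i) (R.zeroˡ _)

    1·-identity : ∀ f → 1# · f ≈ f
    1·-identity f .at i = R.trans (coeff-· 1# f i) (R.*-identityˡ _)

    ≈-setoid : Setoid c ℓ
    ≈-setoid = record
      { Carrier = Poly ; _≈_ = _≈_
      ; isEquivalence = record { refl = ≈-refl ; sym = ≈-sym ; trans = ≈-trans } }

    open SetoidReasoning ≈-setoid

    *-zeroʳ : ∀ f → f * [] ≈ []
    *-zeroʳ []      = ≈-refl
    *-zeroʳ (a ∷ f) = ∷-zero R.refl (*-zeroʳ f)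

    *-congˡ : ∀ f {g g′} → g ≈ g′ → f * g ≈ f * g′
    *-congˡ []      p = ≈-refl
    *-congˡ (a ∷ f) p = +-cong (·-cong R.refl p) (∷-cong R.refl (*-congˡ f p))

    *-distribˡ : ∀ f g h → f * (g + h) ≈ f * g + f * h
    *-distribˡ []      g h = ≈-refl
    *-distribˡ (a ∷ f) g h = begin
      a · (g + h) + (0# ∷ f * (g + h))
        ≈⟨ +-cong (·-distrib a g h)
                  (∷-cong (R.sym (R.+-identityˡ 0#)) (*-distribˡ f g h)) ⟩
      (a · g + a · h) + ((0# ∷ f * g) + (0# ∷ f * h))
        ≈⟨ +-interchange (a · g) (a · h) (0# ∷ f * g) (0# ∷ f * h) ⟩
      (a ∷ f) * g + (a ∷ f) * h ∎

    *-∷ : ∀ f b g → f * (b ∷ g) ≈ b · f + (0# ∷ f * g)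
    *-∷ []      b g = ≈-sym (∷-zero R.refl ≈-refl)
    *-∷ (a ∷ f) b g = ∷-cong (R.+-congʳ (R.*-comm a b)) (begin
      a · g + f * (b ∷ g)              ≈⟨ +-cong ≈-refl (*-∷ f b g) ⟩
      a · g + (b · f + (0# ∷ f * g))   ≈⟨ +-assoc (a · g) (b · f) (0# ∷ f * g) ⟨
      a · g + b · f + (0# ∷ f * g)     ≈⟨ +-cong (+-comm (a · g) (b · f)) ≈-refl ⟩
      b · f + a · g + (0# ∷ f * g)     ≈⟨ +-assoc (b · f) (a · g) (0# ∷ f * g) ⟩
      b · f + (a · g + (0# ∷ f * g))   ∎)

    *-comm : ∀ f g → f * g ≈ g * f
    *-comm []      g = ≈-sym (*-zeroʳ g)
    *-comm (a ∷ f) g =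
      ≈-trans (+-cong ≈-refl (∷-cong R.refl (*-comm f g))) (≈-sym (*-∷ g a f))

    *-cong : ∀ {f f′ g g′} → f ≈ f′ → g ≈ g′ → f * g ≈ f′ * g′
    *-cong {f} {f′} {g} {g′} p q = begin
      f * g    ≈⟨ *-congˡ f q ⟩
      f * g′   ≈⟨ *-comm f g′ ⟩
      g′ * f   ≈⟨ *-congˡ g′ p ⟩
      g′ * f′  ≈⟨ *-comm g′ f′ ⟩
      f′ * g′  ∎

    *-distribʳ : ∀ h f g → (f + g) * h ≈ f * h + g * h
    *-distribʳ h f g = begin
      (f + g) * h     ≈⟨ *-comm (f + g) h ⟩
      h * (f + g)     ≈⟨ *-distribˡ h f g ⟩
      h * f + h * g   ≈⟨ +-cong (*-comm h f) (*-comm h g) ⟩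
      f * h + g * h   ∎

    ·-*-assoc : ∀ a f g → (a · f) * g ≈ a · (f * g)
    ·-*-assoc a []      g = ≈-refl
    ·-*-assoc a (b ∷ f) g = begin
      (a R.* b) · g + (0# ∷ (a · f) * g)
        ≈⟨ +-cong (·-assoc a b g) (∷-cong (R.sym (R.zeroʳ a)) (·-*-assoc a f g)) ⟩
      a · (b · g) + a · (0# ∷ f * g)
        ≈⟨ ·-distrib a (b · g) (0# ∷ f * g) ⟨
      a · ((b ∷ f) * g) ∎

    0∷-* : ∀ {a} → a ≈ᴿ 0# → ∀ f g → (a ∷ f) * g ≈ 0# ∷ f * g
    0∷-* a≈0 f g = +-cong (≈-trans (·-cong a≈0 ≈-refl) (0·-zero g)) ≈-refl

    *-assoc : ∀ f g h → (f * g) * h ≈ f * (g * h)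
    *-assoc []      g h = ≈-refl
    *-assoc (a ∷ f) g h = begin
      (a · g + (0# ∷ f * g)) * h          ≈⟨ *-distribʳ h (a · g) (0# ∷ f * g) ⟩
      (a · g) * h + (0# ∷ f * g) * h      ≈⟨ +-cong (·-*-assoc a g h) (0∷-* R.refl (f * g) h) ⟩
      a · (g * h) + (0# ∷ (f * g) * h)    ≈⟨ +-cong ≈-refl (∷-cong R.refl (*-assoc f g h)) ⟩
      a · (g * h) + (0# ∷ f * (g * h))    ∎

    *-identityˡ : ∀ f → 1ₚ * f ≈ f
    *-identityˡ f =
      ≈-trans (+-cong (1·-identity f) (∷-zero R.refl ≈-refl)) (+-identityʳ f)

    *-identityʳ : ∀ f → f * 1ₚ ≈ f
    *-identityʳ f = ≈-trans (*-comm f 1ₚ) (*-identityˡ f)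

  polyRing : CommutativeRing c ℓ
  polyRing = record
    { Carrier = Poly
    ; _≈_ = _≈_
    ; _+_ = _+_
    ; _*_ = _*_
    ; -_  = -_
    ; 0#  = 0ₚ
    ; 1#  = 1ₚ
    ; isCommutativeRing = record
      { isRing = record
        { +-isAbelianGroup = record
          { isGroup = record
            { isMonoid = record
              { isSemigroup = record
                { isMagma = record
                  { isEquivalence = record { refl = ≈-refl ; sym = ≈-sym ; trans = ≈-trans }
                  ; ∙-cong = +-cong
                  }
                ; assoc = +-assoc
                }
              ; identity = +-identityˡ , +-identityʳ
              }
            ; inverse = neg-inverseˡ , neg-inverseʳ
            ; ⁻¹-cong = neg-cong
            }
          ; comm = +-comm
          }
        ; *-cong = *-cong
        ; *-assoc = *-assoc
        ; *-identity = *-identityˡ , *-identityʳ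
        ; distrib = *-distribˡ , *-distribʳ
        }
      ; *-comm = *-comm
      }
    }

  -- The zero polynomial has no degree.
  _HasDegree_ : Poly → ℕ → Set ℓ
  f HasDegree d = (¬ coeff f d ≈ᴿ 0#) × (∀ i → d ℕ.< i → coeff f i ≈ᴿ 0#)

  HasPositiveDegree : Poly → Set ℓ
  HasPositiveDegree f = ∃[ d ] 0 ℕ.< d × f HasDegree d

  _DegreeLessThan_ : Poly → Poly → Set ℓ
  f DegreeLessThan g = ∃[ d ] ∃[ e ] f HasDegree d × g HasDegree e × d ℕ.< e

  HasPositiveDegree⇒≉0 : ∀ {f} → HasPositiveDegree f → ¬ f ≈ 0ₚ
  HasPositiveDegree⇒≉0 (d , _ , fd≉0 , _) f≈0 = fd≉0 (f≈0 .at d)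

  module _ (_≟0 : ∀ a → Dec (a ≈ᴿ 0#))
           (noZeroDivisors : ∀ a b → ¬ a ≈ᴿ 0# → a R.* b ≈ᴿ 0# → b ≈ᴿ 0#) where
    private
      cancel : ∀ {a} f g → ¬ a ≈ᴿ 0# → (a ∷ f) * g ≈ 0ₚ → g ≈ 0ₚ
      cancel         f []      a≉0 p = ≈-refl
      cancel {a}     f (b ∷ g) a≉0 p = ∷-zero b≈0 (cancel f g a≉0 (tail-zero x∷))
        where
        b≈0 : b ≈ᴿ 0#
        b≈0 = noZeroDivisors a b a≉0
          (R.trans (R.sym (R.+-identityʳ (a R.* b))) (p .at zero))

        x∷ : 0# ∷ (a ∷ f) * g ≈ 0ₚ
        x∷ = begin
          0# ∷ (a ∷ f) * g    ≈⟨ ∷-cong R.refl (*-comm (a ∷ f) g) ⟩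
          0# ∷ g * (a ∷ f)    ≈⟨ 0∷-* b≈0 g (a ∷ f) ⟨
          (b ∷ g) * (a ∷ f)   ≈⟨ *-comm (b ∷ g) (a ∷ f) ⟩
          (a ∷ f) * (b ∷ g)   ≈⟨ p ⟩
          0ₚ                  ∎

    noZeroDivisorsₚ : ∀ f g → f * g ≈ 0ₚ → f ≈ 0ₚ ⊎ g ≈ 0ₚ
    noZeroDivisorsₚ []      g p = inj₁ ≈-refl
    noZeroDivisorsₚ (a ∷ f) g p with a ≟0
    ... | no a≉0  = inj₂ (cancel f g a≉0 p)
    ... | yes a≈0
      with noZeroDivisorsₚ f g (tail-zero (≈-trans (≈-sym (0∷-* a≈0 f g)) p))
    ...   | inj₁ f≈0 = inj₁ (∷-zero a≈0 f≈0)
    ...   | inj₂ g≈0 = inj₂ g≈0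

module RationalFunctions {q : ℕ} (F : FiniteField q c ℓ) where
  private module F = FiniteField F
  open Polynomials F.commutativeRing public
    using (Poly; coeff; HasPositiveDegree; HasPositiveDegree⇒≉0; _HasDegree_; _DegreeLessThan_)
  open Polynomials F.commutativeRing using (polyRing; at; noZeroDivisorsₚ)

  F[x] : CommutativeRing c ℓ
  F[x] = polyRing

  private module P = CommutativeRing F[x]

  1ₚ≉0ₚ : ¬ P.1# P.≈ P.0#
  1ₚ≉0ₚ p = F.1≉0 (p .at 0)

  *-≉0 : ∀ {f g} → ¬ f P.≈ P.0# → ¬ g P.≈ P.0# → ¬ f P.* g P.≈ P.0#
  *-≉0 {f} {g} f≉0 g≉0 fg≈0
    with noZeroDivisorsₚ (F._≟ F.0#) F.noZeroDivisors f g fg≈0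
  ... | inj₁ f≈0 = f≉0 f≈0
  ... | inj₂ g≈0 = g≉0 g≈0

  record RatFun : Set (c ⊔ ℓ) where
    constructor frac
    field
      num   : Poly
      den   : Poly
      den≉0 : ¬ den P.≈ P.0#
  open RatFun public

  F⟨x⟩ : RawRing (c ⊔ ℓ) ℓ
  F⟨x⟩ = record
    { Carrier = RatFun
    ; _≈_ = λ f g → num f P.* den g P.≈ num g P.* den f
    ; _+_ = λ f g → frac (num f P.* den g P.+ num g P.* den f) (den f P.* den g)
                         (*-≉0 (den≉0 f) (den≉0 g))
    ; _*_ = λ f g → frac (num f P.* num g) (den f P.* den g) (*-≉0 (den≉0 f) (den≉0 g))
    ; -_  = λ f → frac (P.- num f) (den f) (den≉0 f)
    ; 0#  = frac P.0# P.1# 1ₚ≉0ₚ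
    ; 1#  = frac P.1# P.1# 1ₚ≉0ₚ
    }

  private module Q = RawRing F⟨x⟩

  fromPoly : Poly → RatFun
  fromPoly f = frac f P.1# 1ₚ≉0ₚ

  reciprocal : (f : Poly) → ¬ f P.≈ P.0# → RatFun
  reciprocal f f≉0 = frac P.1# f f≉0

  -- The valuation with uniformiser 1/x.
  HasValuation : RatFun → ℤ.ℤ → Set ℓ
  HasValuation f v = ∃[ d ] ∃[ e ]
    num f HasDegree d × den f HasDegree e × v ≡.≡ ℤ.+ e ℤ.- ℤ.+ d

  -- The zero function has valuation +∞.
  ValuationAtLeast : RatFun → ℤ.ℤ → Set ℓ
  ValuationAtLeast f n = f Q.≈ Q.0# ⊎ (∃[ v ] HasValuation f v × n ℤ.≤ v)

  -- Convergence for the degree valuation.  As F(x) embeds isometrically in its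
  -- completion F((1/x)), for terms and limit in F(x) this is the same as
  -- convergence in F((1/x)).
  _ConvergesTo_ : (ℕ → RatFun) → RatFun → Set ℓ
  s ConvergesTo f = ∀ (k : ℤ.ℤ) → ∃[ n₀ ] ∀ n → n₀ ℕ.≤ n →
    ValuationAtLeast (f Q.+ (Q.- s n)) k

  private
    open RawSemiringDefs Q.rawSemiring using () renaming (_^_ to _^ᵠ_; sum to sumᵠ)
    open RawSemiringDefs (Semiring.rawSemiring P.semiring) using () renaming (sum to sumᵖ)

  IsDigit : Poly → Poly → Set ℓ
  IsDigit B a = a P.≈ P.0# ⊎ a DegreeLessThan B

  -- a₁ B⁻¹ + ⋯ + aₙ B⁻ⁿ; the value a 0 is never used.
  partialSum : (B : Poly) → ¬ B P.≈ P.0# → (ℕ → Poly) → ℕ → RatFun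
  partialSum B B≉0 a n = sumᵠ {n} λ i →
    fromPoly (a (suc (toℕ i))) Q.* (reciprocal B B≉0 ^ᵠ suc (toℕ i))

  record IsExpansion (B : Poly) (B≉0 : ¬ B P.≈ P.0#) (f : RatFun) (a : ℕ → Poly)
         : Set ℓ where
    field
      digits    : ∀ j → 1 ℕ.≤ j → IsDigit B (a j)
      converges : partialSum B B≉0 a ConvergesTo f

  -- a₁ + ⋯ + aₜ
  digitSum : (ℕ → Poly) → ℕ → Poly
  digitSum a t = sumᵖ {t} λ i → a (suc (toℕ i))

  open CommutativeRing F[x] public using (_≈_; _+_; _*_; _-_; 0#; 1#)
  open RawSemiringDefs (Semiring.rawSemiring P.semiring) public using (Coprime)

-- Long division of 1 by M in base B has remainders ρ₀ = 1 and
-- ρₙ₊₁ = B ρₙ − M aₙ₊₁, and ρₙ ≡ Bⁿ mod M.  Convergence together with the degree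
-- bound on the digits forces deg ρₙ < deg M, so Bᵀ ≡ 1 gives ρ_T = 1.  Summing the
-- recurrence over one period yields M S = (B − 1) (ρ₀ + ⋯ + ρ_{T−1}); as M is
-- coprime to B − 1 it divides the sum of remainders, which has degree below
-- deg M and hence vanishes, and with it S.

module Submission where

open import Defs
open import Algebra.Bundles using (CommutativeRing; Group; RawRing; Semiring)
import Algebra.Definitions.RawMagma as Divisibility
import Algebra.Definitions.RawMonoid as Power
import Algebra.Definitions.RawSemiring as RawSemiringDefs
import Algebra.Properties.CommutativeSemigroup as CommutativeSemigroupProperties
import Algebra.Properties.Group as GroupProperties
import Algebra.Properties.Ring as RingProperties
import Algebra.Properties.Semiring.Exp as Exp
import Algebra.Properties.Semiring.Sum as Sum
import Algebra.Solver.Ring.NaturalCoefficients.Default as SemiringSolver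
open import Data.Empty using (⊥-elim)
open import Data.Fin.Base using (Fin; toℕ) renaming (zero to fzero; suc to fsuc)
open import Data.Fin.Properties using (toℕ-inject₁; toℕ-fromℕ; toℕ<n)
import Data.Integer.Base as ℤ
import Data.Integer.Properties as ℤ
open import Data.List.Base using ([]; _∷_; length)
open import Data.Nat.Base as ℕ using (ℕ; zero; suc; z≤n; s≤s)
import Data.Nat.Properties as ℕ
open import Data.Nat.Solver using (module +-*-Solver)
open import Data.Product.Base using (_×_; _,_; ∃-syntax)
open import Data.Sum.Base using (inj₁; inj₂)
open import Function.Base using (_∘_)
open import Level using (_⊔_)
open import Relation.Binary.PropositionalEquality as ≡ using (_≡_)
import Relation.Binary.Reasoning.Setoid as SetoidReasoning
open import Relation.Nullary.Decidable using (yes; no)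
open import Relation.Nullary.Negation using (¬_)

-- Fraction identities, Bézout relations and long division in a commutative ring.

module _ {c ℓ} (R : CommutativeRing c ℓ) where
  open CommutativeRing R
  open SetoidReasoning setoid
  open SemiringSolver commutativeSemiring using (solve; _:=_; _:+_; _:*_)
  open GroupProperties +-group using () renaming (∙-cancelʳ to +-cancelʳ)
  open RawSemiringDefs (Semiring.rawSemiring semiring) using (_^_; _∣_; sum; Coprime)
  open Divisibility *-rawMagma using (_,_)

  -- Addition of `n₁ / d₁ = u / p` and `n₂ / d₂ = v / p`, kept in cross-multiplied form so that
  -- nothing has to be inverted.
  fraction-sum : ∀ {p n₁ d₁ u n₂ d₂ v} → n₁ * p ≈ u * d₁ → n₂ * p ≈ v * d₂ →
                 (n₁ * d₂ + n₂ * d₁) * p ≈ (u + v) * (d₁ * d₂)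
  fraction-sum {p} {n₁} {d₁} {u} {n₂} {d₂} {v} e₁ e₂ = begin
    (n₁ * d₂ + n₂ * d₁) * p
      ≈⟨ solve 5 (λ n₁ d₂ n₂ d₁ p →
           (n₁ :* d₂ :+ n₂ :* d₁) :* p := (n₁ :* p) :* d₂ :+ (n₂ :* p) :* d₁)
           refl n₁ d₂ n₂ d₁ p ⟩
    n₁ * p * d₂ + n₂ * p * d₁
      ≈⟨ +-cong (*-congʳ e₁) (*-congʳ e₂) ⟩
    u * d₁ * d₂ + v * d₂ * d₁
      ≈⟨ solve 4 (λ u d₁ d₂ v →
           u :* d₁ :* d₂ :+ v :* d₂ :* d₁ := (u :+ v) :* (d₁ :* d₂))
           refl u d₁ d₂ v ⟩
    (u + v) * (d₁ * d₂) ∎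

  -- With `n / d = h / p` this is `1 / m - n / d = (p - m h) / (m p) = r / (m p)`. The factor `1# *
  -- d + - n * m` is the numerator that subtraction in `F⟨x⟩` produces.
  reciprocal-difference : ∀ {m p r h n d} → r + m * h ≈ p → n * p ≈ h * d →
                          (m * p) * (1# * d + - n * m) ≈ (m * d) * r
  -- The term added to both sides cancels the negative part, which leaves semiring identities with
  -- `- n` as an atom.
  reciprocal-difference {m} {p} {r} {h} {n} {d} r+mh≈p np≈hd =
    +-cancelʳ (m * m * (h * d)) _ _ (begin
      (m * p) * (1# * d + - n * m) + m * m * (h * d)
        ≈⟨ +-cong (*-congˡ (+-congʳ (*-identityˡ d))) (*-congˡ (sym np≈hd)) ⟩
      (m * p) * (d + - n * m) + m * m * (n * p)
        ≈⟨ solve 5 (λ m p d x n →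
             (m :* p) :* (d :+ x :* m) :+ m :* m :* (n :* p) :=
             m :* p :* d :+ m :* m :* p :* (x :+ n))
             refl m p d (- n) n ⟩
      m * p * d + m * m * p * (- n + n)
        ≈⟨ +-cong (*-congʳ (*-congˡ (sym r+mh≈p)))
                  (trans (*-congˡ (-‿inverseˡ n)) (zeroʳ _)) ⟩
      m * (r + m * h) * d + 0#
        ≈⟨ +-identityʳ _ ⟩
      m * (r + m * h) * d
        ≈⟨ solve 4 (λ m r h d →
             m :* (r :+ m :* h) :* d := (m :* d) :* r :+ m :* m :* (h :* d))
             refl m r h d ⟩
      (m * d) * r + m * m * (h * d) ∎)

  record Bezout (f g : Carrier) : Set (c ⊔ ℓ) where
    field
      d u v   : Carrier
      d∣f     : d ∣ f
      d∣g     : d ∣ g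
      uf+vg≈d : u * f + v * g ≈ d

  bezout-zero : ∀ {f g} → g ≈ 0# → Bezout f g
  bezout-zero {f} {g} g≈0 = record
    { d = f ; u = 1# ; v = 0#
    ; d∣f = 1# , *-identityˡ f
    ; d∣g = 0# , trans (zeroˡ f) (sym g≈0)
    ; uf+vg≈d = trans (+-cong (*-identityˡ f) (zeroˡ g)) (+-identityʳ f)
    }

  -- One step of Euclid's algorithm: substituting `r = f - q g` turns `u g + v r` into
  -- `v f + (u - v q) g`.
  bezout-step : ∀ {f g r} q → f ≈ q * g + r → Bezout g r → Bezout f g
  bezout-step {f} {g} {r} q f≈qg+r
    record { d = d ; u = u ; v = v ; d∣f = (j , jd≈g) ; d∣g = (k , kd≈r) ; uf+vg≈d = e } = record
    { d = d ; u = v ; v = u + v * - q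
    ; d∣f = q * j + k , (begin
        (q * j + k) * d     ≈⟨ solve 4 (λ q j k d → (q :* j :+ k) :* d := q :* (j :* d) :+ k :* d)
                                 refl q j k d ⟩
        q * (j * d) + k * d ≈⟨ +-cong (*-congˡ jd≈g) kd≈r ⟩
        q * g + r           ≈⟨ f≈qg+r ⟨
        f                   ∎)
    ; d∣g = j , jd≈g
    ; uf+vg≈d = begin
        v * f + (u + v * - q) * g
          ≈⟨ +-congʳ (*-congˡ f≈qg+r) ⟩
        v * (q * g + r) + (u + v * - q) * g
          ≈⟨ solve 6 (λ v q g r u x →
               v :* (q :* g :+ r) :+ (u :+ v :* x) :* g :=
               (u :* g :+ v :* r) :+ v :* (q :+ x) :* g)
               refl v q g r u (- q) ⟩
        (u * g + v * r) + v * (q + - q) * g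
          ≈⟨ +-cong e (trans (*-congʳ (trans (*-congˡ (-‿inverseʳ q)) (zeroʳ v))) (zeroˡ g)) ⟩
        d + 0#
          ≈⟨ +-identityʳ d ⟩
        d ∎
    }

  -- The common divisor `d` of `m` and `c` also divides `b * c`, so coprimality gives `w` with
  -- `w d = 1`. Then `d t = u m t + v c t = (u t + v s) m`, and multiplying by `w` exhibits `t` as a
  -- multiple of `m`.
  coprime-cancel : ∀ {m b c s t} → Coprime m (b * c) → Bezout m c → m * s ≈ c * t → m ∣ t
  coprime-cancel {m} {b} {c} {s} {t} coprime
    record { d = d ; u = u ; v = v ; d∣f = d∣m ; d∣g = (k , kd≈c) ; uf+vg≈d = e } ms≈ct
    with coprime d∣m ((b * k) , trans (*-assoc b k d) (*-congˡ kd≈c))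
  ... | w , wd≈1 = (w * (u * t + v * s)) , (begin
    (w * (u * t + v * s)) * m
      ≈⟨ solve 6 (λ w u t v s m →
           (w :* (u :* t :+ v :* s)) :* m := w :* (u :* m :* t :+ v :* (m :* s)))
           refl w u t v s m ⟩
    w * (u * m * t + v * (m * s))
      ≈⟨ *-congˡ (+-congˡ (*-congˡ ms≈ct)) ⟩
    w * (u * m * t + v * (c * t))
      ≈⟨ solve 6 (λ w u t v c m →
           w :* (u :* m :* t :+ v :* (c :* t)) := w :* (u :* m :+ v :* c) :* t)
           refl w u t v c m ⟩
    w * (u * m + v * c) * t
      ≈⟨ *-congʳ (trans (*-congˡ e) wd≈1) ⟩
    1# * t
      ≈⟨ *-identityˡ t ⟩
    t ∎)

  -- `sum` unfolds at its first term, whereas the long division recurrences add the newest term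
  -- last.
  sum-last : ∀ (f : ℕ → Carrier) n → sum {suc n} (f ∘ toℕ) ≈ sum {n} (f ∘ toℕ) + f n
  sum-last f n = trans (Sum.sum-init-last semiring {n} (f ∘ toℕ))
    (+-cong (Sum.sum-cong-≋ semiring {n} (λ i → reflexive (≡.cong f (toℕ-inject₁ i))))
            (reflexive (≡.cong f (toℕ-fromℕ n))))

  module _ (m : Carrier) where
    private module Q = CommutativeRing (residueRing R m)
    open Group (unitGroup (residueRing R m)) using (rawMonoid)
    open Power rawMonoid using () renaming (_×_ to power)

    -- Translates the order condition, an equation between units, into a congruence for powers of
    -- `b`.
    unit-power : ∀ {b} x → Unit.value x Q.≈ b → ∀ n → Unit.value (power n x) Q.≈ b ^ n
    unit-power x x≈b zero    = Q.refl
    unit-power x x≈b (suc n) = Q.*-cong x≈b (unit-power x x≈b n)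

  -- Bⁿ / M = h n + ρ n / M.
  module LongDivision (B M : Carrier) (a : ℕ → Carrier) where
    ρ h s Σρ : ℕ → Carrier
    ρ zero     = 1#
    ρ (suc n)  = B * ρ n - M * a (suc n)
    h zero     = 0#
    h (suc n)  = h n * B + a (suc n)
    s zero     = 0#
    s (suc n)  = s n + a (suc n)
    Σρ zero    = 0#
    Σρ (suc n) = Σρ n + ρ n

    ρ-step : ∀ n → ρ (suc n) + M * a (suc n) ≈ B * ρ n
    ρ-step n = trans (+-assoc _ _ _) (trans (+-congˡ (-‿inverseˡ _)) (+-identityʳ _))

    ρ+Mh≈Bⁿ : ∀ n → ρ n + M * h n ≈ B ^ n
    ρ+Mh≈Bⁿ zero    = trans (+-congˡ (zeroʳ M)) (+-identityʳ 1#)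
    ρ+Mh≈Bⁿ (suc n) = begin
      ρ (suc n) + M * (h n * B + a (suc n))
        ≈⟨ solve 5 (λ r m h b a →
             r :+ m :* (h :* b :+ a) := (r :+ m :* a) :+ b :* (m :* h))
             refl (ρ (suc n)) M (h n) B (a (suc n)) ⟩
      (ρ (suc n) + M * a (suc n)) + B * (M * h n)
        ≈⟨ +-congʳ (ρ-step n) ⟩
      B * ρ n + B * (M * h n)
        ≈⟨ distribˡ B (ρ n) (M * h n) ⟨
      B * (ρ n + M * h n)
        ≈⟨ *-congˡ (ρ+Mh≈Bⁿ n) ⟩
      B * B ^ n ∎

    -- The sum of `ρ-step` over the first `n` steps. Since `ρ 1 + ... + ρ n = Σρ n + ρ n - 1`,
    -- moving the `1` to the right avoids subtraction.
    telescope : ∀ n → M * s n + Σρ n + ρ n ≈ B * Σρ n + 1#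
    telescope zero    = +-congʳ (trans (+-identityʳ _) (trans (zeroʳ M) (sym (zeroʳ B))))
    telescope (suc n) = begin
      M * (s n + a (suc n)) + (Σρ n + ρ n) + ρ (suc n)
        ≈⟨ solve 6 (λ m s a t r r′ →
             m :* (s :+ a) :+ (t :+ r) :+ r′ := (m :* s :+ t :+ r) :+ (r′ :+ m :* a))
             refl M (s n) (a (suc n)) (Σρ n) (ρ n) (ρ (suc n)) ⟩
      (M * s n + Σρ n + ρ n) + (ρ (suc n) + M * a (suc n))
        ≈⟨ +-cong (telescope n) (ρ-step n) ⟩
      (B * Σρ n + 1#) + B * ρ n
        ≈⟨ solve 4 (λ b t r i → (b :* t :+ i) :+ b :* r := b :* (t :+ r) :+ i)
             refl B (Σρ n) (ρ n) 1# ⟩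
      B * (Σρ n + ρ n) + 1# ∎

    -- A remainder that returns to `ρ 0 = 1` makes the two boundary terms of `telescope` cancel.
    M*s≈[B-1]*Σρ : ∀ n → ρ n ≈ 1# → M * s n ≈ (B - 1#) * Σρ n
    M*s≈[B-1]*Σρ n ρₙ≈1 = +-cancelʳ (Σρ n) _ _ (begin
      M * s n + Σρ n
        ≈⟨ +-cancelʳ 1# _ _ (trans (+-congˡ (sym ρₙ≈1)) (telescope n)) ⟩
      B * Σρ n
        ≈⟨ *-congʳ (trans (+-assoc B _ _) (trans (+-congˡ (-‿inverseˡ 1#)) (+-identityʳ B))) ⟨
      (B - 1# + 1#) * Σρ n
        ≈⟨ trans (distribʳ _ _ _) (+-congˡ (*-identityˡ _)) ⟩
      (B - 1#) * Σρ n + Σρ n ∎)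

    sum≈s : ∀ n → sum {n} (λ i → a (suc (toℕ i))) ≈ s n
    sum≈s zero    = refl
    sum≈s (suc n) = trans (sum-last (a ∘ suc) n) (+-congʳ (sum≈s n))

    -- Horner's rule: `h n` is the numerator of the `n`-th partial sum over the common denominator
    -- `B ^ n`.
    sum≈h : ∀ n → sum {n} (λ i → a (suc (toℕ i)) * B ^ (n ℕ.∸ suc (toℕ i))) ≈ h n
    sum≈h zero    = refl
    sum≈h (suc n) = begin
      sum {suc n} (f (suc n) ∘ toℕ)
        ≈⟨ sum-last (f (suc n)) n ⟩
      sum {n} (f (suc n) ∘ toℕ) + a (suc n) * B ^ (n ℕ.∸ n)
        ≈⟨ +-cong (Sum.sum-cong-≋ semiring {n} (λ i → shift (toℕ i) (toℕ<n i)))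
                  (trans (*-congˡ (reflexive (≡.cong (B ^_) (ℕ.n∸n≡0 n)))) (*-identityʳ _)) ⟩
      sum {n} (λ i → f n (toℕ i) * B) + a (suc n)
        ≈⟨ +-congʳ (Sum.*-distribʳ-sum semiring {n} B (f n ∘ toℕ)) ⟨
      sum {n} (f n ∘ toℕ) * B + a (suc n)
        ≈⟨ +-congʳ (*-congʳ (sum≈h n)) ⟩
      h n * B + a (suc n) ∎
      where
      f : ℕ → ℕ → Carrier
      f n i = a (suc i) * B ^ (n ℕ.∸ suc i)

      shift : ∀ i → i ℕ.< n → f (suc n) i ≈ f n i * B
      shift i i<n = begin
        a (suc i) * B ^ (n ℕ.∸ i)
          -- The bound `i < n` ensures that the truncated subtraction really drops by one.
          ≈⟨ *-congˡ (reflexive (≡.cong (B ^_) (ℕ.+-∸-assoc 1 i<n))) ⟩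
        a (suc i) * (B * B ^ (n ℕ.∸ suc i))
          ≈⟨ *-congˡ (*-comm B _) ⟩
        a (suc i) * (B ^ (n ℕ.∸ suc i) * B)
          ≈⟨ *-assoc _ _ B ⟨
        f n i * B ∎

-- Degree bounds for polynomials over a commutative ring.

module Degree {c ℓ} (A : CommutativeRing c ℓ) where
  private module A = CommutativeRing A
  open Polynomials A
  private module P = CommutativeRing polyRing
  open RawSemiringDefs (Semiring.rawSemiring P.semiring) using (_^_)
  open RingProperties A.ring using (-0#≈0#)

  -- A strict upper bound, unlike `_HasDegree_`, covers the zero polynomial, which is the only one
  -- with bound `0`.
  record DegreeBelow (f : Poly) (n : ℕ) : Set ℓ where
    field
      vanish : ∀ i → n ℕ.≤ i → coeff f i A.≈ A.0#
  open DegreeBelow public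

  coeff-+ : ∀ f g i → coeff (f + g) i A.≈ coeff f i A.+ coeff g i
  coeff-+ []      g       i       = A.sym (A.+-identityˡ _)
  coeff-+ (a ∷ f) []      i       = A.sym (A.+-identityʳ _)
  coeff-+ (a ∷ f) (b ∷ g) zero    = A.refl
  coeff-+ (a ∷ f) (b ∷ g) (suc i) = coeff-+ f g i

  coeff-· : ∀ k f i → coeff (k · f) i A.≈ k A.* coeff f i
  coeff-· k []      i       = A.sym (A.zeroʳ k)
  coeff-· k (b ∷ f) zero    = A.refl
  coeff-· k (b ∷ f) (suc i) = coeff-· k f i

  coeff-neg : ∀ f i → coeff (- f) i A.≈ A.- coeff f i
  coeff-neg []      i       = A.sym -0#≈0#
  coeff-neg (a ∷ f) zero    = A.refl
  coeff-neg (a ∷ f) (suc i) = coeff-neg f i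

  below-resp : ∀ {f g n} → f ≈ g → DegreeBelow f n → DegreeBelow g n
  below-resp f≈g f<n .vanish i n≤i = A.trans (A.sym (f≈g .at i)) (f<n .vanish i n≤i)

  below-mono : ∀ {f m n} → m ℕ.≤ n → DegreeBelow f m → DegreeBelow f n
  below-mono m≤n f<m .vanish i n≤i = f<m .vanish i (ℕ.≤-trans m≤n n≤i)

  below-tail : ∀ {a f n} → DegreeBelow (a ∷ f) (suc n) → DegreeBelow f n
  below-tail f<n .vanish i n≤i = f<n .vanish (suc i) (s≤s n≤i)

  below-shift : ∀ {a f n} → DegreeBelow f n → DegreeBelow (a ∷ f) (suc n)
  below-shift f<n .vanish (suc i) (s≤s n≤i) = f<n .vanish i n≤i

  ≈0⇒below : ∀ {f n} → f ≈ 0ₚ → DegreeBelow f n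
  ≈0⇒below f≈0 .vanish i _ = f≈0 .at i

  below⇒≈0 : ∀ {f} → DegreeBelow f 0 → f ≈ 0ₚ
  below⇒≈0 f<0 .at i = f<0 .vanish i z≤n

  below-1 : DegreeBelow 1ₚ 1
  below-1 .vanish (suc i) _ = A.refl

  below-length : ∀ f → DegreeBelow f (length f)
  below-length []      = ≈0⇒below P.refl
  below-length (a ∷ f) = below-shift (below-length f)

  below-pred : ∀ {f n} → coeff f n A.≈ A.0# → DegreeBelow f (suc n) → DegreeBelow f n
  below-pred {f} {n} fₙ≈0 f<1+n .vanish i n≤i with n ℕ.≟ i
  ... | yes ≡.refl = fₙ≈0
  ... | no  n≢i    = f<1+n .vanish i (ℕ.≤∧≢⇒< n≤i n≢i)

  hasDegree⇒below : ∀ f {n} → f HasDegree n → DegreeBelow f (suc n)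
  hasDegree⇒below f (_ , f<n) .vanish = f<n

  below-+ : ∀ {f g n} → DegreeBelow f n → DegreeBelow g n → DegreeBelow (f + g) n
  below-+ {f} {g} f<n g<n .vanish i n≤i = A.trans (coeff-+ f g i)
    (A.trans (A.+-cong (f<n .vanish i n≤i) (g<n .vanish i n≤i)) (A.+-identityʳ _))

  below-neg : ∀ {f n} → DegreeBelow f n → DegreeBelow (- f) n
  below-neg {f} f<n .vanish i n≤i =
    A.trans (coeff-neg f i) (A.trans (A.-‿cong (f<n .vanish i n≤i)) -0#≈0#)

  below-· : ∀ {k f n} → DegreeBelow f n → DegreeBelow (k · f) n
  below-· {k} {f} f<n .vanish i n≤i =
    A.trans (coeff-· k f i) (A.trans (A.*-congˡ (f<n .vanish i n≤i)) (A.zeroʳ k))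

  shift-zero : ∀ {f} g → f ≈ 0ₚ → A.0# ∷ f * g ≈ 0ₚ
  shift-zero     g f≈0 .at zero    = A.refl
  shift-zero {f} g f≈0 .at (suc i) = P.*-congʳ {g} {f} f≈0 .at i

  -- `deg f ≤ p` and `deg g < q` add up to `deg (f * g) < p + q`; the successor on one factor only
  -- avoids a predecessor in the conclusion.
  below-* : ∀ {f g p q} → DegreeBelow f (suc p) → DegreeBelow g q →
            DegreeBelow (f * g) (p ℕ.+ q)
  below-* {[]}                   f<p g<q = ≈0⇒below P.refl
  below-* {a ∷ f} {g} {zero}     f<p g<q =
    below-+ (below-· g<q) (≈0⇒below (shift-zero g (below⇒≈0 (below-tail f<p))))
  below-* {a ∷ f} {g} {suc p} {q} f<p g<q =
    below-+ (below-mono (ℕ.m≤n+m q (suc p)) (below-· g<q))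
            (below-shift (below-* (below-tail f<p) g<q))

  -- Any other product contributing at index `p + q` has a factor whose index exceeds its degree
  -- bound.
  coeff-* : ∀ {f g} p {q} → DegreeBelow f (suc p) → DegreeBelow g (suc q) →
            coeff (f * g) (p ℕ.+ q) A.≈ coeff f p A.* coeff g q
  coeff-* {[]}            p           f<p g<q = A.sym (A.zeroˡ _)
  coeff-* {a ∷ f} {g} zero    {q} f<p g<q = begin
    coeff (a · g + (A.0# ∷ f * g)) q          ≈⟨ coeff-+ (a · g) _ q ⟩
    coeff (a · g) q A.+ coeff (A.0# ∷ f * g) q
      ≈⟨ A.+-cong (coeff-· a g q) (shift-zero g (below⇒≈0 (below-tail f<p)) .at q) ⟩
    a A.* coeff g q A.+ A.0#                  ≈⟨ A.+-identityʳ _ ⟩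
    a A.* coeff g q                           ∎
    where open SetoidReasoning A.setoid
  coeff-* {a ∷ f} {g} (suc p) {q} f<p g<q = begin
    coeff (a · g + (A.0# ∷ f * g)) (suc p ℕ.+ q)       ≈⟨ coeff-+ (a · g) _ _ ⟩
    coeff (a · g) (suc p ℕ.+ q) A.+ coeff (f * g) (p ℕ.+ q)
      ≈⟨ A.+-cong (below-· g<q .vanish _ (s≤s (ℕ.m≤n+m q p))) (coeff-* p (below-tail f<p) g<q) ⟩
    A.0# A.+ coeff f p A.* coeff g q                   ≈⟨ A.+-identityˡ _ ⟩
    coeff f p A.* coeff g q                            ∎
    where open SetoidReasoning A.setoid

  below-^ : ∀ {f p} → DegreeBelow f (suc p) → ∀ n → DegreeBelow (f ^ n) (suc (n ℕ.* p))
  below-^     f<p zero    = below-1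
  below-^ {p = p} f<p (suc n) =
    ≡.subst (DegreeBelow _) (ℕ.+-suc p (n ℕ.* p)) (below-* f<p (below-^ f<p n))

-- Cancellation, division with remainder and Euclid's algorithm over a finite field.

module FieldDegree {q : ℕ} {c ℓ} (F : FiniteField q c ℓ) where
  private module F = FiniteField F
  open Degree F.commutativeRing
  open Polynomials F.commutativeRing
  private module P = CommutativeRing polyRing
  open RawSemiringDefs (Semiring.rawSemiring P.semiring) using (_∣_)
  open Divisibility P.*-rawMagma using (_,_)

  -- Descent from the list length of `g`: while the bound is `d + k + 1`, the coefficient of `f * g`
  -- at `p + d + k` is the leading coefficient of `f` times that of `g` at `d + k`. It vanishes, so
  -- the bound drops.
  below-cancel : ∀ f {g p d} → f HasDegree p → DegreeBelow (f * g) (p ℕ.+ d) → DegreeBelow g d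
  below-cancel f {g} {p} {d} f-deg@(fₚ≉0 , _) fg<p+d =
    descend (length g) (below-mono (ℕ.m≤n+m _ d) (below-length g))
    where
    descend : ∀ k → DegreeBelow g (d ℕ.+ k) → DegreeBelow g d
    descend zero    g<d     = ≡.subst (DegreeBelow g) (ℕ.+-identityʳ d) g<d
    descend (suc k) g<d+1+k = descend k (below-pred g[d+k]≈0 g<1+d+k)
      where
      g<1+d+k : DegreeBelow g (suc (d ℕ.+ k))
      g<1+d+k = ≡.subst (DegreeBelow g) (ℕ.+-suc d k) g<d+1+k

      g[d+k]≈0 : coeff g (d ℕ.+ k) F.≈ F.0#
      g[d+k]≈0 = F.noZeroDivisors _ _ fₚ≉0
        (F.trans (F.sym (coeff-* p (hasDegree⇒below f f-deg) g<1+d+k))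
                 (fg<p+d .vanish _ (ℕ.+-monoʳ-≤ p (ℕ.m≤m+n d k))))

  -- `below-cancel` with `d = 0` forces the cofactor to be zero.
  multiple-below⇒≈0 : ∀ f {g m} → f HasDegree m → f ∣ g → DegreeBelow g m → g ≈ 0ₚ
  multiple-below⇒≈0 f {g} {m} f-deg (k , kf≈g) g<m = begin
    g       ≈⟨ fk≈g ⟨
    f * k   ≈⟨ P.*-congˡ {f} k≈0 ⟩
    f * 0ₚ  ≈⟨ P.zeroʳ f ⟩
    0ₚ      ∎
    where
    open SetoidReasoning P.setoid
    fk≈g : f * k ≈ g
    fk≈g = P.trans (P.*-comm f k) kf≈g

    k≈0 : k ≈ 0ₚ
    k≈0 = below⇒≈0 (below-cancel f f-deg
      (≡.subst (DegreeBelow (f * k)) (≡.sym (ℕ.+-identityʳ m)) (below-resp (P.sym fk≈g) g<m)))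

  -- Recursion on the coefficients: if `f = q g + r`, then `a + x f = x q g + (a + x r)`, and the
  -- new remainder has degree at most `n`. Subtracting the scalar multiple of `g` with the same
  -- coefficient at `n` restores the bound.
  divide : ∀ g {n} → g HasDegree n → ∀ f → ∃[ q ] ∃[ r ] f ≈ q * g + r × DegreeBelow r n
  divide g g-deg [] = [] , [] , P.refl , ≈0⇒below P.refl
  divide g {n} g-deg@(gₙ≉0 , _) (a ∷ f) with divide g g-deg f | F.invertible _ gₙ≉0
  ... | q , r , f≈qg+r , r<n | gₙ⁻¹ , gₙ⁻¹gₙ≈1 , _ =
    k ∷ q , ar + - kg , equation ,
    below-pred lead (below-+ (below-shift r<n) (below-neg (below-· (hasDegree⇒below g g-deg))))
    where
    ar = a ∷ r
    k  = coeff ar n F.* gₙ⁻¹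
    kg = k · g

    lead : coeff (ar + - kg) n F.≈ F.0#
    lead = begin
      coeff (ar + - kg) n                   ≈⟨ coeff-+ ar (- kg) n ⟩
      coeff ar n F.+ coeff (- kg) n         ≈⟨ F.+-congˡ (coeff-neg kg n) ⟩
      coeff ar n F.- coeff kg n             ≈⟨ F.+-congˡ (F.-‿cong (coeff-· k g n)) ⟩
      coeff ar n F.- k F.* coeff g n        ≈⟨ F.+-congˡ (F.-‿cong (F.*-assoc _ _ _)) ⟩
      coeff ar n F.- coeff ar n F.* (gₙ⁻¹ F.* coeff g n)
        ≈⟨ F.+-congˡ (F.-‿cong (F.trans (F.*-congˡ gₙ⁻¹gₙ≈1) (F.*-identityʳ _))) ⟩
      coeff ar n F.- coeff ar n             ≈⟨ F.-‿inverseʳ _ ⟩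
      F.0#                                  ∎
      where open SetoidReasoning F.setoid

    shifted : a ∷ f ≈ (F.0# ∷ q * g) + ar
    shifted .at zero    = F.sym (F.+-identityˡ a)
    shifted .at (suc i) = f≈qg+r .at i

    equation : a ∷ f ≈ (k ∷ q) * g + (ar + - kg)
    equation = begin
      a ∷ f                       ≈⟨ shifted ⟩
      xqg + ar                    ≈⟨ P.+-identityʳ (xqg + ar) ⟨
      (xqg + ar) + 0ₚ             ≈⟨ P.+-congˡ {xqg + ar} (P.-‿inverseʳ kg) ⟨
      (xqg + ar) + (kg + - kg)    ≈⟨ interchange xqg ar kg (- kg) ⟩
      (xqg + kg) + (ar + - kg)    ≈⟨ P.+-congʳ {ar + - kg} (P.+-comm xqg kg) ⟩
      (kg + xqg) + (ar + - kg)    ∎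
      where
      open SetoidReasoning P.setoid
      open CommutativeSemigroupProperties P.+-commutativeSemigroup using (interchange)
      xqg = F.0# ∷ q * g

  -- Trailing zeros can make the list length overshoot the degree of `g`. The bound is lowered until
  -- its top coefficient is nonzero; only then is there a degree to divide by, and the remainder
  -- satisfies a smaller bound.
  bezout : ∀ f g → Bezout polyRing f g
  bezout f g = euclid (length g) f g (below-length g)
    where
    euclid : ∀ n f g → DegreeBelow g n → Bezout polyRing f g
    euclid zero    f g g<0 = bezout-zero polyRing (below⇒≈0 g<0)
    euclid (suc n) f g g<1+n with coeff g n F.≟ F.0#
    ... | yes gₙ≈0 = euclid n f g (below-pred gₙ≈0 g<1+n)
    ... | no  gₙ≉0 with divide g (gₙ≉0 , g<1+n .vanish) f
    ...   | q , r , f≈qg+r , r<n = bezout-step polyRing q f≈qg+r (euclid n g r r<n)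

-- Partial sums, the degree valuation and the remainders of the expansion.

module Expansions {q : ℕ} {c ℓ} (F : FiniteField q c ℓ) where
  private module F = FiniteField F
  open RationalFunctions F
  open Polynomials F.commutativeRing using (noZeroDivisorsₚ)
  open Degree F.commutativeRing
  open FieldDegree F
  private
    module P = CommutativeRing F[x]
    module Q = RawRing F⟨x⟩
  open RawSemiringDefs (Semiring.rawSemiring P.semiring) using (_^_; _∣_; sum)
  open RawSemiringDefs Q.rawSemiring using () renaming (_^_ to _^ᵠ_; sum to sumᵠ)
  open Divisibility P.*-rawMagma using (_,_)

  digit⇒below : ∀ B a {b} → B HasDegree b → IsDigit B a → DegreeBelow a b
  digit⇒below B a _         (inj₁ a≈0) = ≈0⇒below a≈0
  digit⇒below B a (_ , B<b) (inj₂ (d , e , a-deg , (Bₑ≉0 , _) , d<e)) =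
    -- The digit condition carries its own degree `e` of `B`; a nonzero coefficient at `e` excludes
    -- `b < e`.
    below-mono (ℕ.≤-trans d<e (ℕ.≮⇒≥ (λ b<e → Bₑ≉0 (B<b e b<e)))) (hasDegree⇒below a a-deg)

  -- f = u / p, cross-multiplied so that p need not be nonzero.
  record Represents (p : Poly) (f : RatFun) (u : Poly) : Set ℓ where
    field
      cross : num f * p ≈ u * den f
  open Represents

  sum-represents : ∀ {p} n (f : Fin n → RatFun) (u : Fin n → Poly) →
                   (∀ i → Represents p (f i) (u i)) → Represents p (sumᵠ f) (sum u)
  sum-represents     zero    f u e .cross = P.refl
  sum-represents {p} (suc n) f u e .cross =
    fraction-sum F[x] {p} {num (f fzero)} {den (f fzero)} {u fzero} {num f′} {den f′} {sum u′}
      (e fzero .cross) (sum-represents n (f ∘ fsuc) u′ (e ∘ fsuc) .cross)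
    where
    f′ = sumᵠ (f ∘ fsuc)
    u′ = u ∘ fsuc

  module _ (B : Poly) (B≉0 : ¬ B ≈ 0#) where
    num-reciprocal-^ : ∀ k → num (reciprocal B B≉0 ^ᵠ k) ≈ 1#
    num-reciprocal-^ zero    = P.refl
    num-reciprocal-^ (suc k) = P.trans (P.*-identityˡ _) (num-reciprocal-^ k)

    den-reciprocal-^ : ∀ k → den (reciprocal B B≉0 ^ᵠ k) ≈ B ^ k
    den-reciprocal-^ zero    = P.refl
    den-reciprocal-^ (suc k) = P.*-congˡ {B} (den-reciprocal-^ k)

    -- Brings every term of a partial sum to the common denominator `B ^ n`.
    term-represents : ∀ {k n} → k ℕ.≤ n → ∀ f →
      Represents (B ^ n) (fromPoly f Q.* (reciprocal B B≉0 ^ᵠ k)) (f * B ^ (n ℕ.∸ k))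
    term-represents {k} {n} k≤n f .cross = begin
      f * num rec^k * B ^ n
        ≈⟨ P.*-cong (P.trans (P.*-congˡ {f} (num-reciprocal-^ k)) (P.*-identityʳ f)) Bⁿ ⟩
      f * (B ^ (n ℕ.∸ k) * B ^ k)
        ≈⟨ P.*-assoc f (B ^ (n ℕ.∸ k)) (B ^ k) ⟨
      f * B ^ (n ℕ.∸ k) * B ^ k
        ≈⟨ P.*-congˡ {f * B ^ (n ℕ.∸ k)} (P.trans (P.*-identityˡ _) (den-reciprocal-^ k)) ⟨
      f * B ^ (n ℕ.∸ k) * (1# * den rec^k) ∎
      where
      open SetoidReasoning P.setoid
      rec^k = reciprocal B B≉0 ^ᵠ k
      Bⁿ : B ^ n ≈ B ^ (n ℕ.∸ k) * B ^ k
      Bⁿ = P.trans (P.reflexive (≡.cong (B ^_) (≡.sym (ℕ.m∸n+n≡m k≤n))))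
                   (Exp.^-homo-* P.semiring B (n ℕ.∸ k) k)

    partialSum-represents : ∀ M a n → let open LongDivision F[x] B M a in
      Represents (B ^ n) (partialSum B B≉0 a n) (h n)
    partialSum-represents M a n .cross = P.trans
      (sum-represents n _ _ (λ i → term-represents (toℕ<n i) (a (suc (toℕ i)))) .cross)
      (P.*-congʳ {den (partialSum B B≉0 a n)} (LongDivision.sum≈h F[x] B M a n))

  product-zero : ∀ f g → ¬ f ≈ 0# → f * g ≈ 0# → g ≈ 0#
  product-zero f g f≉0 fg≈0 with noZeroDivisorsₚ (F._≟ F.0#) F.noZeroDivisors f g fg≈0
  ... | inj₁ f≈0 = ⊥-elim (f≉0 f≈0)
  ... | inj₂ g≈0 = g≈0

  private
    valuation-bound : ∀ {d e n} → ℤ.+ n ℤ.≤ ℤ.+ e ℤ.- ℤ.+ d → n ℕ.+ d ℕ.≤ e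
    valuation-bound {d} {e} {n} n≤e-d = ℤ.drop‿+≤+ (begin
      ℤ.+ n ℤ.+ ℤ.+ d                ≤⟨ ℤ.+-monoˡ-≤ (ℤ.+ d) n≤e-d ⟩
      ℤ.+ e ℤ.- ℤ.+ d ℤ.+ ℤ.+ d      ≡⟨ ℤ.+-assoc (ℤ.+ e) (ℤ.- ℤ.+ d) (ℤ.+ d) ⟩
      ℤ.+ e ℤ.+ (ℤ.- ℤ.+ d ℤ.+ ℤ.+ d) ≡⟨ ≡.cong (ℤ._+_ (ℤ.+ e)) (ℤ.+-inverseˡ (ℤ.+ d)) ⟩
      ℤ.+ e ℤ.+ ℤ.0ℤ                 ≡⟨ ℤ.+-identityʳ (ℤ.+ e) ⟩
      ℤ.+ e                          ∎)
      where open ℤ.≤-Reasoning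

  -- For nonzero `p` the equation says `f = r / p`, so valuation at least `n` gives
  -- `deg r ≤ k - n < d`.
  valuation⇒below : ∀ f p r {n k d} → p * num f ≈ den f * r → DegreeBelow p (suc k) →
                    suc k ℕ.≤ n ℕ.+ d → ValuationAtLeast f (ℤ.+ n) → DegreeBelow r d
  valuation⇒below f p r pf≈gr p<1+k 1+k≤n+d (inj₁ f≈0) =
    ≈0⇒below (product-zero (den f) r (den≉0 f) (begin
      den f * r   ≈⟨ pf≈gr ⟨
      -- `f≈0` is the cross-multiplied `num f * 1# ≈ 0# * den f`, whose right side computes to `0#`.
      p * num f   ≈⟨ P.*-congˡ {p} (P.trans (P.sym (P.*-identityʳ (num f))) f≈0) ⟩
      p * 0#      ≈⟨ P.zeroʳ p ⟩
      0#          ∎))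
    where open SetoidReasoning P.setoid
  valuation⇒below f p r {n} {k} {d} pf≈gr p<1+k 1+k≤n+d
    (inj₂ (_ , (i , j , num-deg , den-deg , ≡.refl) , n≤j-i)) =
    below-cancel (den f) den-deg (below-mono bound (below-resp pf≈gr
      (below-* p<1+k (hasDegree⇒below (num f) num-deg))))
    where
    open ℕ.≤-Reasoning
    bound : k ℕ.+ suc i ℕ.≤ j ℕ.+ d
    bound = begin
      k ℕ.+ suc i       ≡⟨ ℕ.+-suc k i ⟩
      suc k ℕ.+ i       ≤⟨ ℕ.+-monoˡ-≤ i 1+k≤n+d ⟩
      n ℕ.+ d ℕ.+ i     ≡⟨ xy∙z≈xz∙y n d i ⟩
      n ℕ.+ i ℕ.+ d     ≤⟨ ℕ.+-monoˡ-≤ d (valuation-bound n≤j-i) ⟩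
      j ℕ.+ d           ∎
      where open CommutativeSemigroupProperties ℕ.+-commutativeSemigroup using (xy∙z≈xz∙y)

  module _ {B M : Poly} {b m : ℕ} (B-deg : B HasDegree b) (M-deg : M HasDegree m)
           (B≉0 : ¬ B ≈ 0#) (M≉0 : ¬ M ≈ 0#) {a : ℕ → Poly}
           (expansion : IsExpansion B B≉0 (reciprocal M M≉0) a) where
    open LongDivision F[x] B M a
    open IsExpansion expansion

    -- For `N = j + n` the error of the partial sum is `ρ N / (M * B ^ N)`, with denominator of
    -- degree `m + (j + n) b`. A valuation above `n b` leaves less than `m + j b` for the degree of
    -- `ρ N`.
    valuation⇒remainder-below : ∀ n j S → Represents (B ^ (j ℕ.+ n)) S (h (j ℕ.+ n)) →
      ValuationAtLeast (reciprocal M M≉0 Q.+ (Q.- S)) (ℤ.+ suc (n ℕ.* b)) →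
      DegreeBelow (ρ (j ℕ.+ n)) (m ℕ.+ j ℕ.* b)
    valuation⇒remainder-below n j S S≈h/Bᴺ =
      valuation⇒below (reciprocal M M≉0 Q.+ (Q.- S)) (M * B ^ N) (ρ N)
        (reciprocal-difference F[x] {M} {B ^ N} {ρ N} {h N} {num S} {den S}
          (ρ+Mh≈Bⁿ N) (S≈h/Bᴺ .cross))
        (≡.subst (DegreeBelow (M * B ^ N)) (ℕ.+-suc m (N ℕ.* b))
          (below-* (hasDegree⇒below M M-deg) (below-^ (hasDegree⇒below B B-deg) N)))
        (ℕ.≤-reflexive (solve 4 (λ m n j b →
          con 1 :+ (m :+ (j :+ n) :* b) := (con 1 :+ n :* b) :+ (m :+ j :* b)) ≡.refl m n j b))
      where
      open +-*-Solver
      N = j ℕ.+ n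

    -- Were ρ n of degree at least m, each further step would raise the degree
    -- by exactly b, because the digit term M aₙ₊₁ has degree below m + b.
    remainder-below-descend : ∀ n j → DegreeBelow (ρ (j ℕ.+ n)) (m ℕ.+ j ℕ.* b) →
                              DegreeBelow (ρ n) m
    remainder-below-descend n zero    ρ< = ≡.subst (DegreeBelow (ρ n)) (ℕ.+-identityʳ m) ρ<
    remainder-below-descend n (suc j) ρ< = remainder-below-descend n j
      (below-cancel B B-deg (below-resp (ρ-step (j ℕ.+ n)) (below-+
        (≡.subst (DegreeBelow _) rearrange ρ<)
        (below-mono bound (below-* (hasDegree⇒below M M-deg)
          (digit⇒below B _ B-deg (digits (suc (j ℕ.+ n)) (s≤s z≤n))))))))
      where
      rearrange : m ℕ.+ (b ℕ.+ j ℕ.* b) ≡ b ℕ.+ (m ℕ.+ j ℕ.* b)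
      rearrange = solve 3 (λ m b x → m :+ (b :+ x) := b :+ (m :+ x)) ≡.refl m b (j ℕ.* b)
        where open +-*-Solver

      bound : m ℕ.+ b ℕ.≤ b ℕ.+ (m ℕ.+ j ℕ.* b)
      bound = ≡.subst (m ℕ.+ b ℕ.≤_) rearrange (ℕ.+-monoʳ-≤ m (ℕ.m≤m+n b _))

    remainder-below : ∀ n → DegreeBelow (ρ n) m
    -- The precision depends on `n` alone. The resulting `n₀` then serves as the number of extra
    -- steps, since `n₀ + n` is past the threshold.
    remainder-below n with converges (ℤ.+ suc (n ℕ.* b))
    ... | n₀ , close = remainder-below-descend n n₀
      (valuation⇒remainder-below n n₀ _ (partialSum-represents B B≉0 M a (n₀ ℕ.+ n))
        (close (n₀ ℕ.+ n) (ℕ.m≤m+n n₀ n)))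

    Σρ-below : ∀ n → DegreeBelow (Σρ n) m
    Σρ-below zero    = ≈0⇒below P.refl
    Σρ-below (suc n) = below-+ (Σρ-below n) (remainder-below n)

    open CommutativeRing (residueRing F[x] M) using () renaming (_≈_ to _≋_)

    -- From `ρ n = B ^ n - M h n` and `B ^ n - 1 = k M`, the difference `ρ n - 1` is `(k - h n) M`.
    -- Its degree is below `m`, where `0 < m` accounts for the constant `1`, so it vanishes.
    remainder≈1 : 0 ℕ.< m → ∀ n → B ^ n ≋ 1# → ρ n ≈ 1#
    remainder≈1 0<m n (mod (k , kM≈Bⁿ-1)) = x∙y⁻¹≈ε⇒x≈y _ _ (multiple-below⇒≈0 M M-deg
      (k - h n , multiple)
      (below-+ (remainder-below n) (below-neg (below-mono 0<m below-1))))
      where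
      open GroupProperties P.+-group using (x∙y⁻¹≈ε⇒x≈y) renaming (∙-cancelʳ to +-cancelʳ)
      open CommutativeSemigroupProperties P.+-commutativeSemigroup using (xy∙z≈xz∙y)
      open SetoidReasoning P.setoid

      multiple : (k - h n) * M ≈ ρ n - 1#
      multiple = +-cancelʳ (M * h n) _ _ (begin
        (k - h n) * M + M * h n
          ≈⟨ P.+-congˡ {(k - h n) * M} (P.*-comm M (h n)) ⟩
        (k - h n) * M + h n * M
          ≈⟨ P.distribʳ M (k - h n) (h n) ⟨
        (k - h n + h n) * M
          ≈⟨ P.*-congʳ {M} (P.trans (P.+-assoc k (P.- h n) (h n))
               (P.trans (P.+-congˡ {k} (P.-‿inverseˡ (h n))) (P.+-identityʳ k))) ⟩
        k * M
          ≈⟨ kM≈Bⁿ-1 ⟩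
        B ^ n - 1#
          ≈⟨ P.+-congʳ {P.- 1#} (ρ+Mh≈Bⁿ n) ⟨
        ρ n + M * h n - 1#
          ≈⟨ xy∙z≈xz∙y (ρ n) (M * h n) (P.- 1#) ⟩
        ρ n - 1# + M * h n ∎)

    digitSum≈0 : 0 ℕ.< m → Coprime M (B * (B - 1#)) → ∀ n → B ^ n ≋ 1# → digitSum a n ≈ 0#
    digitSum≈0 0<m coprime n Bⁿ≋1 = P.trans (sum≈s n) s≈0
      where
      open SetoidReasoning P.setoid

      Ms≈[B-1]Σρ : M * s n ≈ (B - 1#) * Σρ n
      Ms≈[B-1]Σρ = M*s≈[B-1]*Σρ n (remainder≈1 0<m n Bⁿ≋1)

      M∣Σρ : M ∣ Σρ n
      M∣Σρ = coprime-cancel F[x] {M} {B} {B - 1#} {s n} coprime (bezout M (B - 1#)) Ms≈[B-1]Σρ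

      Σρ≈0 : Σρ n ≈ 0#
      Σρ≈0 = multiple-below⇒≈0 M M-deg M∣Σρ (Σρ-below n)

      Ms≈0 : M * s n ≈ 0#
      Ms≈0 = begin
        M * s n           ≈⟨ Ms≈[B-1]Σρ ⟩
        (B - 1#) * Σρ n   ≈⟨ P.*-congˡ {B - 1#} Σρ≈0 ⟩
        (B - 1#) * 0#     ≈⟨ P.zeroʳ (B - 1#) ⟩
        0#                ∎

      s≈0 : s n ≈ 0#
      s≈0 = product-zero M (s n) M≉0 Ms≈0

theorem1 : ∀ {c ℓ} {q : ℕ} (F : FiniteField q c ℓ) →
    let open RationalFunctions F in
    (B M : Poly)
    (deg-B>0 : HasPositiveDegree B) (deg-M>0 : HasPositiveDegree M) →
    Coprime M (B * (B - 1#)) →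
    (T : ℕ) → HasUnitOrder (residueRing F[x] M) B T →
    (a : ℕ → Poly) →
    IsExpansion B (HasPositiveDegree⇒≉0 deg-B>0)
    (reciprocal M (HasPositiveDegree⇒≉0 deg-M>0)) a →
    digitSum a T ≈ 0#
theorem1 F B M deg-B>0@(_ , _ , B-deg) deg-M>0@(_ , 0<m , M-deg) coprime T
  (u , u≈B , order) a expansion =
  digitSum≈0 B-deg M-deg
    (HasPositiveDegree⇒≉0 deg-B>0) (HasPositiveDegree⇒≉0 deg-M>0) expansion
    -- The unit `u` represents the class of `B`, so `u` to the power `T` being trivial means that
    -- `B ^ T` is congruent to `1` modulo `M`.
    0<m coprime T (Q.trans (Q.sym (unit-power F[x] M u u≈B T)) (IsOrder.power≈ε order))
  where
  open RationalFunctions F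
  open Expansions F
  module Q = CommutativeRing (residueRing F[x] M)
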